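{- If $T$ is a subcubic tree of order $n$ and dissociation number $\psi$, then $\Phi(T)\le 1.466^{4n-5\psi+2}$.
   Context: All graphs are finite, simple and undirected. A subcubic tree is a tree of maximum degree at most $3$. A dissociation set in a graph $G$ is a vertex subset $F$ such that the induced subgraph $G[F]$ has maximum degree at most $1$; a maximum dissociation set is one of maximum cardinality, and the dissociation number $\psi(G)$ is that cardinality. $\Phi(G)$ denotes the number of maximum dissociation sets of $G$. -}

module Defs where

open import Data.Fin.Base using (Fin)
open import Data.Fin.Properties using (all?)
open import Data.Fin.Subset using (Subset; inside; outside; _∈_; _∩_; ∣_∣)
open import Data.Fin.Subset.Properties using (_∈?_; anySubset?)
open import Data.Integer.Base using (ℤ; +_; -[1+_])
open import Data.List.Base using (List; []; _∷_; _++_; _∷ʳ_; map; filter; length)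
open import Data.List.Extrema.Nat using (max; max≈v⁺)
open import Data.List.Membership.Propositional renaming (_∈_ to _∈ᴸ_) using ()
open import Data.List.Membership.Propositional.Properties using (∈-map⁺; ∈-map⁻; ∈-++⁺ˡ; ∈-++⁺ʳ; ∈-filter⁺; ∈-filter⁻)
open import Data.List.Relation.Unary.All as All using ([])
open import Data.List.Relation.Unary.Any using (here)
open import Data.List.Relation.Unary.Linked using (Linked)
open import Data.List.Relation.Unary.Unique.Propositional using (Unique; []; _∷_)
open import Data.List.Relation.Unary.Unique.Propositional.Properties using (map⁺; ++⁺)
open import Data.Nat.Base using (ℕ; zero; suc; _≤_; z≤n)
open import Data.Nat.Properties using (_≤?_)
open import Data.Product.Base using (_×_; _,_)
open import Data.Rational.Base as ℚ using (ℚ; 1/_)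
open import Data.Vec.Base using ([]; _∷_; tabulate)
open import Data.Vec.Properties using (∷-injectiveʳ)
open import Level using (0ℓ)
open import Relation.Binary.Construct.Closure.ReflexiveTransitive using (Star)
open import Relation.Binary.Core using (Rel)
open import Relation.Binary.Definitions using (Symmetric)
import Relation.Binary.Definitions as Binary
open import Relation.Binary.PropositionalEquality using (_≡_; refl; sym)
open import Relation.Nullary.Decidable using (does; _×-dec_; _→-dec_; ¬?; decidable-stable)
import Relation.Nullary.Decidable as Dec
open import Relation.Nullary.Negation using (¬_)
open import Relation.Unary using (Decidable)
import Algebra.Definitions.RawSemiring as RawSemiringDefinitions

open RawSemiringDefinitions ℚ.+-*-rawSemiring using () renaming (_^_ to _^ℕ_)

record Graph (n : ℕ) : Set₁ where
  infix 4 _~_ _~?_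
  field
    _~_    : Rel (Fin n) 0ℓ
    _~?_   : Binary.Decidable _~_
    ~-sym  : Symmetric _~_
    ~-irr  : ∀ {v} → ¬ (v ~ v)

  neighbours : Fin n → Subset n
  neighbours v = tabulate (λ w → does (v ~? w))

  degree : Fin n → ℕ
  degree v = ∣ neighbours v ∣

  -- For v ∈ F this is the degree of v in the induced subgraph G[F].
  degreeIn : Subset n → Fin n → ℕ
  degreeIn F v = ∣ neighbours v ∩ F ∣

  Connected : Set
  Connected = ∀ u v → Star _~_ u v

  -- x ∷ xs lists the vertices of a cycle in cyclic order; a cycle in a
  -- simple graph has at least three vertices.
  IsCycle : Fin n → List (Fin n) → Set
  IsCycle x xs = 2 ≤ length xs × Unique (x ∷ xs) × Linked _~_ (x ∷ xs ∷ʳ x)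

  Acyclic : Set
  Acyclic = ∀ x xs → ¬ IsCycle x xs

  record IsTree : Set where
    field
      nonEmpty  : 1 ≤ n
      connected : Connected
      acyclic   : Acyclic

  Subcubic : Set
  Subcubic = ∀ v → degree v ≤ 3

subsets : ∀ n → List (Subset n)
subsets zero    = [] ∷ []
subsets (suc n) = map (inside ∷_) (subsets n) ++ map (outside ∷_) (subsets n)

subsets-complete : ∀ {n} (F : Subset n) → F ∈ᴸ subsets n
subsets-complete []            = here refl
subsets-complete (inside ∷ F)  = ∈-++⁺ˡ (∈-map⁺ (inside ∷_) (subsets-complete F))
subsets-complete {suc n} (outside ∷ F) =
  ∈-++⁺ʳ (map (inside ∷_) (subsets n)) (∈-map⁺ (outside ∷_) (subsets-complete F))

subsets-unique : ∀ n → Unique (subsets n)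
subsets-unique zero    = [] ∷ []
subsets-unique (suc n) =
  ++⁺ (map⁺ ∷-injectiveʳ (subsets-unique n)) (map⁺ ∷-injectiveʳ (subsets-unique n)) disjoint
  where
  disjoint : ∀ {F} → ¬ (F ∈ᴸ map (inside ∷_) (subsets n) × F ∈ᴸ map (outside ∷_) (subsets n))
  disjoint (p , q) with ∈-map⁻ (inside ∷_) p | ∈-map⁻ (outside ∷_) q
  ... | _ , _ , refl | _ , _ , ()

module _ {n : ℕ} (G : Graph n) where
  open Graph G

  IsDissociationSet : Subset n → Set
  IsDissociationSet F = ∀ v → v ∈ F → degreeIn F v ≤ 1

  IsMaximumDissociationSet : Subset n → Set
  IsMaximumDissociationSet F =
    IsDissociationSet F × (∀ F′ → IsDissociationSet F′ → ∣ F′ ∣ ≤ ∣ F ∣)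

  isDissociationSet? : Decidable IsDissociationSet
  isDissociationSet? F = all? λ v → (v ∈? F) →-dec (degreeIn F v ≤? 1)

  isMaximumDissociationSet? : Decidable IsMaximumDissociationSet
  isMaximumDissociationSet? F = isDissociationSet? F ×-dec
    Dec.map′ (λ ¬larger F′ → decidable-stable (bounded? F′) λ ¬b → ¬larger (F′ , ¬b))
             (λ bounded (F′ , ¬b) → ¬b (bounded F′))
             (¬? (anySubset? (λ F′ → ¬? (bounded? F′))))
    where
    bounded? : Decidable (λ F′ → IsDissociationSet F′ → ∣ F′ ∣ ≤ ∣ F ∣)
    bounded? F′ = isDissociationSet? F′ →-dec (∣ F′ ∣ ≤? ∣ F ∣)

  ψ : ℕ
  ψ = max 0 (map ∣_∣ (filter isDissociationSet? (subsets n)))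

  maximum⇒∣F∣≡ψ : ∀ {F} → IsMaximumDissociationSet F → ∣ F ∣ ≡ ψ
  maximum⇒∣F∣≡ψ {F} (diss , bound) = sym (max≈v⁺
    (∈-map⁺ ∣_∣ (∈-filter⁺ isDissociationSet? (subsets-complete F) diss))
    (All.tabulate bounded) z≤n)
    where
    bounded : ∀ {k} → k ∈ᴸ map ∣_∣ (filter isDissociationSet? (subsets n)) → k ≤ ∣ F ∣
    bounded k∈ with ∈-map⁻ ∣_∣ k∈
    ... | F′ , F′∈ , refl with ∈-filter⁻ isDissociationSet? {xs = subsets n} F′∈
    ... | _ , diss′ = bound F′ diss′

  Φ : ℕ
  Φ = length (filter isMaximumDissociationSet? (subsets n))

infixr 8 _^_

_^_ : (q : ℚ) .{{_ : ℚ.NonZero q}} → ℤ → ℚ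
q ^ (+ k)    = q ^ℕ k
q ^ -[1+ k ] = (1/ q) ^ℕ suc k

{-# OPTIONS --safe #-}
module Submission where

-- Root the tree. For the branch hanging at a vertex consider three families of dissociation sets: those
-- omitting the root, those containing it as an isolated vertex, and those containing it together with a
-- neighbour. The pairs (maximum size, number of sets of that size) of these families are computed by a
-- max-plus recursion along the tree. Normalise a count N attached to size m in a branch of order n to
-- N β^(5m − 4n), where β = 1.466. The differences between the maximum sizes take finitely many values,
-- and a finite table of upper bounds for the normalised counts is stable under joining at most two
-- branches to a new root. Joining at most three branches of the table gives a normalised total count of
-- at most β², which is the claim.

open import Defs
open import Algebra.Bundles using (CommutativeMonoid)
open import Data.Bool.Base using (Bool; true; false; if_then_else_; T; _∧_)
open import Data.Bool.ListAction using (all; any)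
open import Data.Bool.Properties using (T-∧)
open import Data.Empty using (⊥-elim)
open import Data.Fin.Base using (Fin; zero; suc; fromℕ<)
open import Data.Fin.Properties using (_≟_; any?)
open import Data.Fin.Subset using (Subset; inside; outside; _∈_; _∉_; _⊆_; _∩_; _∪_; _-_; ⁅_⁆; ⊤; ⊥; ∣_∣)
open import Data.Fin.Subset.Properties
open import Data.Integer.Base as ℤ using (+_; _⊖_)
import Data.Integer.Properties as ℤ
open import Data.List.Base using (List; []; _∷_; _++_; _∷ʳ_; map; filter; length; allFin; cartesianProductWith)
open import Data.List.Membership.DecPropositional using () renaming (_∈?_ to member?)
open import Data.List.Membership.Propositional using (find) renaming (_∈_ to _∈ᴸ_; _∉_ to _∉ᴸ_)
open import Data.List.Membership.Propositional.Properties using (∈-∃++; ∈-++⁻; ∈-++⁺ˡ; ∈-++⁺ʳ; ∈-filter⁺; ∈-filter⁻; ∈-allFin; ∈-cartesianProductWith⁺)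
open import Data.List.Properties using (length-++; length-map)
open import Data.List.Relation.Unary.All as All using (All; []; _∷_)
open import Data.List.Relation.Unary.All.Properties using (¬Any⇒All¬; all⁺)
open import Data.List.Relation.Unary.Any using (here; there)
open import Data.List.Relation.Unary.Any.Properties using (any⁻)
open import Data.List.Relation.Unary.Linked using (Linked; [-]; _∷_)
open import Data.List.Relation.Unary.Unique.Propositional using (Unique; []; _∷_)
import Data.List.Relation.Unary.Unique.Propositional.Properties as Unique
open import Data.Nat.Base as ℕ using (ℕ; zero; suc; z≤n; s≤s; _⊔_; _+_; _*_; _∸_; _≡ᵇ_; _≤ᵇ_; NonZero)
import Data.Nat.Properties as ℕ
open import Data.Nat.Tactic.RingSolver using (solve-∀)
open import Data.Product.Base using (∃; ∃₂; _×_; _,_; proj₁; proj₂)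
open import Data.Rational.Base as ℚ using (ℚ; _≤_; _/_; 1/_; 1ℚ; Positive)
import Data.Rational.Properties as ℚ
open import Data.Rational.Unnormalised.Base as ℚᵘ using (mkℚᵘ; *≡*; *≤*)
import Data.Rational.Unnormalised.Properties as ℚᵘ
open import Data.Sum.Base using (_⊎_; inj₁; inj₂; [_,_]′)
open import Data.Unit.Base using (tt)
open import Data.Vec.Base using ([]; _∷_; here; there)
open import Data.Vec.Properties using (lookup∘tabulate; lookup⇒[]=; []=⇒lookup)
open import Function.Bundles using (Equivalence)
open import Relation.Binary.Construct.Closure.ReflexiveTransitive using (Star; ε; _◅_; _◅◅_)
open import Relation.Binary.PropositionalEquality using (_≡_; _≢_; refl; sym; trans; cong; cong₂; subst; subst₂; module ≡-Reasoning)
open import Relation.Nullary.Decidable using (yes; no; _×-dec_; dec-true; does)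
open import Relation.Nullary.Negation using (¬_; contradiction)
open import Algebra.Definitions.RawSemiring ℚ.+-*-rawSemiring using () renaming (_^_ to _^ℕ_)
open import Algebra.Properties.CommutativeSemigroup (CommutativeMonoid.commutativeSemigroup ℚ.*-1-commutativeMonoid) using (interchange; x∙yz≈y∙xz)

-- Rooted decomposition of a subcubic tree.

unique⇒length≤∣p∣ : ∀ {n} {p : Subset n} {xs} → Unique xs → All (_∈ p) xs → length xs ℕ.≤ ∣ p ∣
unique⇒length≤∣p∣ [] [] = z≤n
unique⇒length≤∣p∣ {p = p} {x ∷ _} (x≢ ∷ u) (x∈p ∷ xs⊆p) =
  ℕ.≤-trans (s≤s (unique⇒length≤∣p∣ u (All.zipWith remains (xs⊆p , x≢)))) (x∈p⇒∣p-x∣<∣p∣ x∈p)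
  where
  remains : ∀ {y} → y ∈ p × x ≢ y → y ∈ p - x
  remains (y∈p , x≢y) = x∈p∧x≢y⇒x∈p-y y∈p λ y≡x → x≢y (sym y≡x)

x∉p-x : ∀ {n} {p : Subset n} {x} → x ∉ p - x
x∉p-x {p = _ ∷ p} {zero}  ()
x∉p-x {p = _ ∷ p} {suc x} (there x∈) = x∉p-x {p = p} x∈

module Structure {n : ℕ} (G : Graph n) where
  open Graph G

  ∈neighbours⁺ : ∀ {v w} → v ~ w → w ∈ neighbours v
  ∈neighbours⁺ {v} {w} v~w = lookup⇒[]= w (neighbours v)
    (trans (lookup∘tabulate (λ x → does (v ~? x)) w) (dec-true (v ~? w) v~w))

  ∈neighbours⁻ : ∀ {v w} → w ∈ neighbours v → v ~ w
  ∈neighbours⁻ {v} {w} w∈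
    with v ~? w | trans (sym (lookup∘tabulate (λ x → does (v ~? x)) w)) ([]=⇒lookup w∈)
  ... | yes v~w | _ = v~w
  ... | no  _   | ()

  -- Piece k v X: the subgraph induced by X is a tree rooted at v, v has k
  -- children and every other vertex at most two.
  data Piece : ℕ → Fin n → Subset n → Set where
    single : ∀ v → Piece 0 v ⁅ v ⁆
    attach : ∀ {k v X l c Y} → Piece k v X → Piece l c Y → l ℕ.≤ 2 →
             (∀ {x} → x ∈ X → x ∉ Y) → v ~ c →
             (∀ {x y} → x ∈ X → y ∈ Y → x ~ y → x ≡ v × y ≡ c) →
             Piece (suc k) v (X ∪ Y)

  root∈ : ∀ {k v X} → Piece k v X → v ∈ X
  root∈ (single v)               = x∈⁅x⁆ v
  root∈ (attach p _ _ _ _ _) = p⊆p∪q _ (root∈ p)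

  -- Only the vertices after the first are required to lie in `R`; lemmas that need the start in `R`
  -- assume it separately.
  Reach : Subset n → Fin n → Fin n → Set
  Reach R = Star (λ x y → x ~ y × y ∈ R)

  reach-∈ : ∀ {R x y} → x ∈ R → Reach R x y → y ∈ R
  reach-∈ x∈R ε = x∈R
  reach-∈ _   ((_ , y∈R) ◅ p) = reach-∈ y∈R p

  reach-sym : ∀ {R x y} → x ∈ R → Reach R x y → Reach R y x
  reach-sym x∈R ε                 = ε
  reach-sym x∈R ((x~a , a∈R) ◅ p) = reach-sym a∈R p ◅◅ ((~-sym x~a , x∈R) ◅ ε)

  -- A walk without repeated vertices, all of them in `R`; the list holds the vertices after the
  -- first, so that consing the start gives the format of `IsCycle`.
  data Path (R : Subset n) (y : Fin n) : Fin n → List (Fin n) → Set where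
    stop : y ∈ R → Path R y y []
    step : ∀ {x a as} → x ∈ R → x ~ a → x ∉ᴸ a ∷ as → Path R y a as → Path R y x (a ∷ as)

  path-suffix : ∀ {R x y a as} → Path R y a as → x ∈ᴸ a ∷ as → ∃ (Path R y x)
  path-suffix p              (here refl) = _ , p
  path-suffix (step _ _ _ p) (there x∈)  = path-suffix p x∈

  -- Loop erasure: if the new start already occurs on the path built so far, the suffix from that
  -- occurrence is kept instead.
  reach⇒path : ∀ {R x y} → x ∈ R → Reach R x y → ∃ (Path R y x)
  reach⇒path x∈R ε = _ , stop x∈R
  reach⇒path {x = x} x∈R (_◅_ {j = a} (x~a , a∈R) r) with reach⇒path a∈R r
  ... | as , p with member? _≟_ x (a ∷ as)
  ...   | yes x∈ = path-suffix p x∈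
  ...   | no  x∉ = _ , step x∈R x~a x∉ p

  path-all : ∀ {R x y xs} → Path R y x xs → All (_∈ R) (x ∷ xs)
  path-all (stop y∈R)         = y∈R ∷ []
  path-all (step x∈R _ _ p) = x∈R ∷ path-all p

  path-unique : ∀ {R x y xs} → Path R y x xs → Unique (x ∷ xs)
  path-unique (stop _)         = [] ∷ []
  path-unique (step _ _ x∉ p) = ¬Any⇒All¬ _ x∉ ∷ path-unique p

  path-linked : ∀ {R x y xs v} → Path R y x xs → y ~ v → Linked _~_ (x ∷ xs ∷ʳ v)
  path-linked (stop _)         y~v = y~v ∷ [-]
  path-linked (step _ x~a _ p) y~v = x~a ∷ path-linked p y~v

  children : Subset n → Fin n → List (Fin n)
  children R v = filter (λ c → (v ~? c) ×-dec (c ∈? (R - v))) (allFin n)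

  children-unique : ∀ R v → Unique (children R v)
  children-unique R v = Unique.filter⁺ _ (Unique.allFin⁺ n)

  children-sound : ∀ R v {c} → c ∈ᴸ children R v → v ~ c × c ∈ R - v
  children-sound R v c∈ = proj₂ (∈-filter⁻ _ {xs = allFin n} c∈)

  children-complete : ∀ R v {c} → v ~ c → c ∈ R - v → c ∈ᴸ children R v
  children-complete R v v~c c∈ = ∈-filter⁺ _ (∈-allFin _) (v~c , c∈)

  children-bound : ∀ R v → length (children R v) ℕ.≤ degree v
  children-bound R v = unique⇒length≤∣p∣ (children-unique R v)
    (All.tabulate λ c∈ → ∈neighbours⁺ (proj₁ (children-sound R v c∈)))

  -- The parent is a neighbour outside `R` and takes one place in the degree. In a subcubic graph
  -- this leaves at most two children.
  children-bound-parent : ∀ {R v p} → v ~ p → p ∉ R → suc (length (children R v)) ℕ.≤ degree v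
  children-bound-parent {R} {v} {p} v~p p∉R = unique⇒length≤∣p∣ {xs = p ∷ children R v}
    (¬Any⇒All¬ _ p∉ ∷ children-unique R v)
    (∈neighbours⁺ v~p ∷ All.tabulate λ c∈ → ∈neighbours⁺ (proj₁ (children-sound R v c∈)))
    where
    p∉ : p ∉ᴸ children R v
    p∉ p∈ = p∉R (p─q⊆p R ⁅ v ⁆ (proj₂ (children-sound R v p∈)))

  -- `sound` and `closed` pin `X` down as the set reachable from `v` inside `R`.
  record Explored (R : Subset n) (v : Fin n) : Set where
    field
      {X}    : Subset n
      piece  : Piece (length (children R v)) v X
      sound  : ∀ {x} → x ∈ X → Reach R v x
      closed : ∀ {x y} → x ∈ X → x ~ y → y ∈ R → y ∈ X

  -- The stage at which the children in `cs` have been attached to `v`. The root is exempt from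
  -- `closed`, as its other neighbours may still be missing.
  record Partial (R : Subset n) (v : Fin n) (cs : List (Fin n)) : Set where
    field
      {X}     : Subset n
      piece   : Piece (length cs) v X
      sound   : ∀ {x} → x ∈ X → x ≡ v ⊎ (∃ λ c → c ∈ᴸ cs × Reach (R - v) c x)
      closed  : ∀ {x y} → x ∈ X → x ~ y → y ∈ R - v → x ≡ v ⊎ y ∈ X
      covered : ∀ {c} → c ∈ᴸ cs → c ∈ X

  module _ (acyclic : Acyclic) (subcubic : Subcubic) where

    -- A simple path from `c` to `d` in `R - v`, closed up through `v`, would be a cycle unless it
    -- is trivial.
    neighbours-separated : ∀ {R v c d} → v ~ c → v ~ d → c ∈ R - v → Reach (R - v) c d → c ≡ d
    neighbours-separated {R} {v} {c} {d} v~c v~d c∈ r with reach⇒path c∈ r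
    ... | [] , stop _ = refl
    ... | xs@(_ ∷ _) , p = contradiction
      (s≤s (s≤s z≤n) , All.map avoids (path-all p) ∷ path-unique p , v~c ∷ path-linked p (~-sym v~d))
      (acyclic v (c ∷ xs))
      where
      avoids : ∀ {x} → x ∈ R - v → v ≢ x
      avoids x∈ v≡x = x∉p-x (subst (_∈ R - v) (sym v≡x) x∈)

    -- Each child is explored in `R - v`. Acyclicity makes these components disjoint and leaves
    -- `v ~ c` as the only edge between the new component and what is already attached.
    partial : ∀ {R v} cs → Unique cs → All (λ c → v ~ c × c ∈ R - v) cs →
              (∀ {c} → c ∈ R - v → Explored (R - v) c) → Partial R v cs
    partial {v = v} [] _ _ _ = record
      { piece = single v
      ; sound = λ x∈ → inj₁ (x∈⁅y⁆⇒x≡y v x∈)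
      ; closed = λ x∈ _ _ → inj₁ (x∈⁅y⁆⇒x≡y v x∈)
      ; covered = λ ()
      }
    partial {R} {v} (c ∷ cs) (c∉ ∷ u) ((v~c , c∈) ∷ all) explore = record
      { piece   = attach T.piece S.piece few disjoint v~c edges
      ; sound   = sound
      ; closed  = closed
      ; covered = covered
      }
      where
      module T = Partial (partial cs u all explore)
      module S = Explored (explore c∈)

      few : length (children (R - v) c) ℕ.≤ 2
      few = ℕ.≤-pred (ℕ.≤-trans (children-bound-parent (~-sym v~c) x∉p-x) (subcubic c))

      apart : ∀ {d x} → d ∈ᴸ cs → Reach (R - v) d x → ¬ Reach (R - v) c x
      apart d∈ rd rc with All.lookup all d∈
      ... | v~d , d∈R = All.lookup c∉ d∈
        (neighbours-separated v~c v~d c∈ (rc ◅◅ reach-sym d∈R rd))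

      disjoint : ∀ {x} → x ∈ T.X → x ∉ S.X
      disjoint x∈T x∈S with T.sound x∈T
      ... | inj₁ refl = x∉p-x (reach-∈ c∈ (S.sound x∈S))
      ... | inj₂ (d , d∈ , rd) = apart d∈ rd (S.sound x∈S)

      edges : ∀ {x y} → x ∈ T.X → y ∈ S.X → x ~ y → x ≡ v × y ≡ c
      edges x∈T y∈S x~y with T.sound x∈T
      -- Here `y` is a neighbour of `v` reachable from `c` while avoiding `v`, so it is `c` itself.
      ... | inj₁ refl = refl , sym (neighbours-separated v~c x~y c∈ (S.sound y∈S))
      ... | inj₂ (d , d∈ , rd) =
        -- The edge would extend a walk from the earlier child `d` into the component of `c`.
        ⊥-elim (apart d∈ (rd ◅◅ ((x~y , reach-∈ c∈ (S.sound y∈S)) ◅ ε)) (S.sound y∈S))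

      sound : ∀ {x} → x ∈ T.X ∪ S.X → x ≡ v ⊎ (∃ λ d → d ∈ᴸ c ∷ cs × Reach (R - v) d x)
      sound x∈ with x∈p∪q⁻ T.X S.X x∈
      ... | inj₂ x∈S = inj₂ (c , here refl , S.sound x∈S)
      ... | inj₁ x∈T with T.sound x∈T
      ...   | inj₁ x≡v = inj₁ x≡v
      ...   | inj₂ (d , d∈ , r) = inj₂ (d , there d∈ , r)

      closed : ∀ {x y} → x ∈ T.X ∪ S.X → x ~ y → y ∈ R - v → x ≡ v ⊎ y ∈ T.X ∪ S.X
      closed x∈ x~y y∈ with x∈p∪q⁻ T.X S.X x∈
      ... | inj₂ x∈S = inj₂ (q⊆p∪q T.X S.X (S.closed x∈S x~y y∈))
      ... | inj₁ x∈T with T.closed x∈T x~y y∈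
      ...   | inj₁ x≡v = inj₁ x≡v
      ...   | inj₂ y∈T = inj₂ (p⊆p∪q S.X y∈T)

      covered : ∀ {d} → d ∈ᴸ c ∷ cs → d ∈ T.X ∪ S.X
      covered (here refl) = q⊆p∪q T.X S.X (root∈ S.piece)
      covered (there d∈)  = p⊆p∪q S.X (T.covered d∈)

    -- Induction on a bound `m` for the size of the region, which shrinks when `v` is deleted.
    explore : ∀ m {R v} → ∣ R ∣ ℕ.≤ m → v ∈ R → Explored R v
    explore zero    ∣R∣≤0 v∈R = contradiction (ℕ.≤-trans (x∈p⇒∣p-x∣<∣p∣ v∈R) ∣R∣≤0) λ ()
    explore (suc m) {R} {v} ∣R∣≤ v∈R = record { piece = P.piece ; sound = sound ; closed = closed }
      where
      module P = Partial (partial {R} {v} (children R v) (children-unique R v)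
                 (All.tabulate (children-sound R v))
                 (explore m (ℕ.≤-pred (ℕ.≤-trans (x∈p⇒∣p-x∣<∣p∣ v∈R) ∣R∣≤))))

      widen : ∀ {x y} → Reach (R - v) x y → Reach R x y
      widen ε = ε
      widen ((x~a , a∈) ◅ r) = (x~a , p─q⊆p R ⁅ v ⁆ a∈) ◅ widen r

      sound : ∀ {x} → x ∈ P.X → Reach R v x
      sound x∈ with P.sound x∈
      ... | inj₁ refl = ε
      ... | inj₂ (c , c∈ , r) with children-sound R v c∈
      ...   | v~c , c∈R = (v~c , p─q⊆p R ⁅ v ⁆ c∈R) ◅ widen r

      closed : ∀ {x y} → x ∈ P.X → x ~ y → y ∈ R → y ∈ P.X
      closed {x} {y} x∈ x~y y∈R with y ≟ v
      ... | yes refl = root∈ P.piece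
      ... | no  y≢v with x∈p∧x≢y⇒x∈p-y y∈R y≢v
      ...   | y∈ with P.closed x∈ x~y y∈
      ...     | inj₁ refl = P.covered (children-complete R v x~y y∈)
      ...     | inj₂ y∈X  = y∈X

    -- The root has no parent, so all three neighbours may become children. The piece explored in
    -- `⊤` is closed under adjacency, hence connectedness makes it everything.
    decomposition : Connected → (v : Fin n) → ∃ λ k → k ℕ.≤ 3 × Piece k v ⊤
    decomposition connected v = _ , ℕ.≤-trans (children-bound ⊤ v) (subcubic v) ,
      subst (Piece _ v) (⊆-antisym ⊆⊤ λ {x} _ → closure (root∈ E.piece) (connected v x)) E.piece
      where
      module E = Explored (explore ∣ ⊤ {n} ∣ {⊤} {v} ℕ.≤-refl ∈⊤)
      closure : ∀ {x y} → x ∈ E.X → Star _~_ x y → y ∈ E.X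
      closure x∈ ε = x∈
      closure x∈ (x~a ◅ r) = closure (E.closed x∈ x~a ∈⊤) r

-- Max-plus counting of dissociation sets in rooted pieces.

disjoint⇒∣p∪q∣≡∣p∣+∣q∣ : ∀ {n} (p q : Subset n) → (∀ {x} → x ∈ p → x ∉ q) → ∣ p ∪ q ∣ ≡ ∣ p ∣ + ∣ q ∣
disjoint⇒∣p∪q∣≡∣p∣+∣q∣ [] [] _ = refl
disjoint⇒∣p∪q∣≡∣p∣+∣q∣ (inside ∷ p) (inside ∷ q) d = contradiction here (d here)
disjoint⇒∣p∪q∣≡∣p∣+∣q∣ (inside ∷ p) (outside ∷ q) d =
  cong suc (disjoint⇒∣p∪q∣≡∣p∣+∣q∣ p q λ x∈p x∈q → d (there x∈p) (there x∈q))
disjoint⇒∣p∪q∣≡∣p∣+∣q∣ (outside ∷ p) (inside ∷ q) d = trans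
  (cong suc (disjoint⇒∣p∪q∣≡∣p∣+∣q∣ p q λ x∈p x∈q → d (there x∈p) (there x∈q)))
  (sym (ℕ.+-suc _ _))
disjoint⇒∣p∪q∣≡∣p∣+∣q∣ (outside ∷ p) (outside ∷ q) d =
  disjoint⇒∣p∪q∣≡∣p∣+∣q∣ p q λ x∈p x∈q → d (there x∈p) (there x∈q)

subsingleton⇒∣p∣≤1 : ∀ {n} (p : Subset n) → (∀ {x y} → x ∈ p → y ∈ p → x ≡ y) → ∣ p ∣ ℕ.≤ 1
subsingleton⇒∣p∣≤1 {n} p single with nonempty? p
... | yes (x , x∈p) = subst (∣ p ∣ ℕ.≤_) (∣⁅x⁆∣≡1 x)
  (p⊆q⇒∣p∣≤∣q∣ λ {y} y∈p → subst (_∈ ⁅ x ⁆) (single x∈p y∈p) (x∈⁅x⁆ x))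
... | no  empty = ℕ.≤-trans
  (p⊆q⇒∣p∣≤∣q∣ {q = ⊥} λ y∈p → contradiction (_ , y∈p) empty)
  (ℕ.≤-trans (ℕ.≤-reflexive (∣⊥∣≡0 n)) z≤n)

length-cartesianProductWith : ∀ {A B C : Set} (f : A → B → C) xs ys →
  length (cartesianProductWith f xs ys) ≡ length xs * length ys
length-cartesianProductWith f []       ys = refl
length-cartesianProductWith f (x ∷ xs) ys = trans (length-++ (map (f x) ys))
  (cong₂ _+_ (length-map (f x) ys) (length-cartesianProductWith f xs ys))

-- (m , N): the maximum size of a family of sets and the number of its members of that size.
Lead : Set
Lead = ℕ × ℕ

infixl 6 _⊕_
infixl 7 _⊗_

truncate : ℕ → Lead → ℕ
truncate M (m , N) = if m ≡ᵇ M then N else 0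

-- Sum and product of leading terms N x^m of generating polynomials by size. In a sum, only the
-- summands of top degree contribute.
_⊕_ _⊗_ : Lead → Lead → Lead
x ⊕ y = M , truncate M x + truncate M y
  where M = proj₁ x ⊔ proj₁ y
(m , N) ⊗ (m′ , N′) = m + m′ , N * N′

record State : Set where
  constructor state
  field out isolated matched : Lead

  total : Lead
  total = out ⊕ isolated ⊕ matched

open State

-- The leads out, isolated and total: the parent of a branch sees the matched sets only through the total.
View : Set
View = Lead × Lead × Lead

toView : State → View
toView s = out s , isolated s , total s

infixl 5 _◂_

-- An omitted root puts no condition on the new branch. An isolated root forces the child out. A
-- matched root has its partner either in an earlier branch, which forces the child out, or in the
-- child, in which case both are isolated on their own sides.
_◂_ : State → View → State
state o i m ◂ (o′ , i′ , t′) = state (o ⊗ t′) (i ⊗ o′) (m ⊗ o′ ⊕ i ⊗ i′)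

-- There is no matched set, so the size 0 in the last component is a placeholder.
leaf : State
leaf = state (0 , 1) (1 , 1) (0 , 0)

module Counting {n : ℕ} (G : Graph n) where
  open Graph G
  open Structure G

  -- The degree condition without cardinalities: any two neighbours inside `F` coincide.
  Dissociated : Subset n → Set
  Dissociated F = ∀ {v a b} → v ∈ F → a ∈ F → b ∈ F → v ~ a → v ~ b → a ≡ b

  dissociated⁺ : ∀ {F} → IsDissociationSet G F → Dissociated F
  dissociated⁺ {F} d {v} {a} {b} v∈ a∈ b∈ v~a v~b with a ≟ b
  ... | yes a≡b = a≡b
  ... | no  a≢b = contradiction (ℕ.≤-trans
    (unique⇒length≤∣p∣ {xs = a ∷ b ∷ []} ((a≢b ∷ []) ∷ [] ∷ [])
       (x∈p∩q⁺ (∈neighbours⁺ v~a , a∈) ∷ x∈p∩q⁺ (∈neighbours⁺ v~b , b∈) ∷ [])) (d v v∈)) λ { (s≤s ()) }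

  dissociated⁻ : ∀ {F} → Dissociated F → IsDissociationSet G F
  dissociated⁻ {F} d v v∈ = subsingleton⇒∣p∣≤1 _ λ x∈ y∈ →
    let v~x , x∈F = x∈p∩q⁻ (neighbours v) F x∈
        v~y , y∈F = x∈p∩q⁻ (neighbours v) F y∈
    in d v∈ x∈F y∈F (∈neighbours⁻ v~x) (∈neighbours⁻ v~y)

  Isolated Matched : Fin n → Subset n → Set
  Isolated v F = ∀ {y} → y ∈ F → ¬ (v ~ y)
  Matched v F = ∃ λ y → y ∈ F × v ~ y

  Sets : Subset n → Subset n → Set
  Sets X F = F ⊆ X × Dissociated F

  Out In⁰ In¹ : Subset n → Fin n → Subset n → Set
  Out X v F = Sets X F × v ∉ F
  In⁰ X v F = Sets X F × v ∈ F × Isolated v F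
  In¹ X v F = Sets X F × v ∈ F × Matched v F

  classify : ∀ {X v F} → Sets X F → (Out X v F ⊎ In⁰ X v F) ⊎ In¹ X v F
  classify {v = v} {F} s with v ∈? F | any? (λ y → (y ∈? F) ×-dec (v ~? y))
  ... | no  v∉ | _      = inj₁ (inj₁ (s , v∉))
  ... | yes v∈ | no ¬m  = inj₁ (inj₂ (s , v∈ , λ y∈ v~y → ¬m (_ , y∈ , v~y)))
  ... | yes v∈ | yes m  = inj₂ (s , v∈ , m)

  -- Upper bounds only: `list` may repeat sets or contain sets outside `P`, so products need no
  -- injectivity of the union.
  record Leads (P : Subset n → Set) (ℓ : Lead) : Set where
    field
      bounded  : ∀ {F} → P F → ∣ F ∣ ℕ.≤ proj₁ ℓ
      list     : List (Subset n)
      short    : length list ℕ.≤ proj₂ ℓ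
      complete : ∀ {F} → P F → ∣ F ∣ ≡ proj₁ ℓ → F ∈ᴸ list

  -- No member reaches a size above the bound, so there the empty list serves, in accordance with
  -- the value 0 of `truncate`.
  raise : ∀ {P ℓ M} → Leads P ℓ → proj₁ ℓ ℕ.≤ M → Leads P (M , truncate M ℓ)
  raise {P} {m , N} {M} L m≤M with m ℕ.≟ M
  ... | yes refl = record
    { bounded = bounded ; list = list ; complete = complete
    ; short = subst (length list ℕ.≤_) (sym (lemma m)) short }
    where
    open Leads L
    lemma : ∀ m → truncate m (m , N) ≡ N
    lemma zero    = refl
    lemma (suc m) = lemma m
  ... | no m≢M = record
    { bounded = λ p → ℕ.≤-trans (bounded p) m≤M ; list = [] ; short = z≤n
    ; complete = λ p ∣F∣≡M → contradiction (ℕ.≤-antisym m≤M (subst (ℕ._≤ m) ∣F∣≡M (bounded p))) m≢M }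
    where open Leads L

  leads-⊕ : ∀ {P P₁ P₂ ℓ₁ ℓ₂} → (∀ {F} → P F → P₁ F ⊎ P₂ F) →
            Leads P₁ ℓ₁ → Leads P₂ ℓ₂ → Leads P (ℓ₁ ⊕ ℓ₂)
  leads-⊕ {ℓ₁ = m₁ , _} {m₂ , _} split L₁ L₂ = record
    { bounded  = λ p → [ R₁.bounded , R₂.bounded ]′ (split p)
    ; list     = R₁.list ++ R₂.list
    ; short    = ℕ.≤-trans (ℕ.≤-reflexive (length-++ R₁.list)) (ℕ.+-mono-≤ R₁.short R₂.short)
    ; complete = λ p e →
        [ (λ p₁ → ∈-++⁺ˡ (R₁.complete p₁ e)) , (λ p₂ → ∈-++⁺ʳ R₁.list (R₂.complete p₂ e)) ]′ (split p)
    }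
    where
    module R₁ = Leads (raise L₁ (ℕ.m≤m⊔n m₁ m₂))
    module R₂ = Leads (raise L₂ (ℕ.m≤n⊔m m₁ m₂))

  +-tight : ∀ {a b c d} → a ℕ.≤ c → b ℕ.≤ d → a + b ≡ c + d → a ≡ c × b ≡ d
  +-tight {a} {b} {c} {d} a≤c b≤d e with ℕ.m≤n⇒m<n∨m≡n a≤c
  ... | inj₁ a<c = contradiction e (ℕ.<⇒≢ (ℕ.+-mono-<-≤ a<c b≤d))
  ... | inj₂ refl = refl , ℕ.+-cancelˡ-≡ a b d e

  -- Sizes add, so the size `m₁ + m₂` forces both parts to be of top size, by `+-tight`; the
  -- candidates are therefore all unions of listed parts.
  leads-⊗ : ∀ {P P₁ P₂ ℓ₁ ℓ₂} →
            (∀ {F} → P F → ∃₂ λ F₁ F₂ → F ≡ F₁ ∪ F₂ × ∣ F ∣ ≡ ∣ F₁ ∣ + ∣ F₂ ∣ × P₁ F₁ × P₂ F₂) →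
            Leads P₁ ℓ₁ → Leads P₂ ℓ₂ → Leads P (ℓ₁ ⊗ ℓ₂)
  leads-⊗ {P} {ℓ₁ = m₁ , _} {m₂ , _} split L₁ L₂ = record
    { bounded  = bounded
    ; list     = cartesianProductWith _∪_ L₁.list L₂.list
    ; short    = ℕ.≤-trans (ℕ.≤-reflexive (length-cartesianProductWith _∪_ L₁.list L₂.list))
        (ℕ.*-mono-≤ L₁.short L₂.short)
    ; complete = complete
    }
    where
    module L₁ = Leads L₁
    module L₂ = Leads L₂
    bounded : ∀ {F} → P F → ∣ F ∣ ℕ.≤ m₁ + m₂
    bounded p with split p
    ... | _ , _ , refl , e , p₁ , p₂ =
      ℕ.≤-trans (ℕ.≤-reflexive e) (ℕ.+-mono-≤ (L₁.bounded p₁) (L₂.bounded p₂))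
    complete : ∀ {F} → P F → ∣ F ∣ ≡ m₁ + m₂ → F ∈ᴸ cartesianProductWith _∪_ L₁.list L₂.list
    complete p e′ with split p
    ... | _ , _ , refl , e , p₁ , p₂ with +-tight (L₁.bounded p₁) (L₂.bounded p₂) (trans (sym e) e′)
    ...   | e₁ , e₂ = ∈-cartesianProductWith⁺ _∪_ (L₁.complete p₁ e₁) (L₂.complete p₂ e₂)

  eval : ∀ {k v X} → Piece k v X → State
  eval (single _)           = leaf
  eval (attach p q _ _ _ _) = eval p ◂ toView (eval q)

  module Join {X Y : Subset n} {v c : Fin n} (disjoint : ∀ {x} → x ∈ X → x ∉ Y)
              (v∈X : v ∈ X) (c∈Y : c ∈ Y) (v~c : v ~ c)
              (edges : ∀ {x y} → x ∈ X → y ∈ Y → x ~ y → x ≡ v × y ≡ c) where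

    split-∪ : ∀ {F} → F ⊆ X ∪ Y → F ≡ (F ∩ X) ∪ (F ∩ Y) × ∣ F ∣ ≡ ∣ F ∩ X ∣ + ∣ F ∩ Y ∣
    split-∪ {F} F⊆ = F≡ , trans (cong ∣_∣ F≡) (disjoint⇒∣p∪q∣≡∣p∣+∣q∣ (F ∩ X) (F ∩ Y)
        λ x∈ y∈ → disjoint (p∩q⊆q F X x∈) (p∩q⊆q F Y y∈))
      where
      F≡ : F ≡ (F ∩ X) ∪ (F ∩ Y)
      F≡ = ⊆-antisym
        (λ x∈F → x∈p∪q⁺ ([ (λ x∈X → inj₁ (x∈p∩q⁺ (x∈F , x∈X))) , (λ x∈Y → inj₂ (x∈p∩q⁺ (x∈F , x∈Y))) ]′
                          (x∈p∪q⁻ X Y (F⊆ x∈F))))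
        (λ x∈ → [ p∩q⊆p F X , p∩q⊆p F Y ]′ (x∈p∪q⁻ (F ∩ X) (F ∩ Y) x∈))

    restrict : ∀ {F} Z → Dissociated F → Sets Z (F ∩ Z)
    restrict {F} Z d = p∩q⊆q F Z , λ v∈ a∈ b∈ → d (p∩q⊆p F Z v∈) (p∩q⊆p F Z a∈) (p∩q⊆p F Z b∈)

    ∩-∈ : ∀ {F Z : Subset n} {x} → x ∈ F → x ∈ Z → x ∈ F ∩ Z
    ∩-∈ x∈F x∈Z = x∈p∩q⁺ (x∈F , x∈Z)

    Split : (P₁ P₂ : Subset n → Set) → Subset n → Set
    Split P₁ P₂ F = ∃₂ λ F₁ F₂ → F ≡ F₁ ∪ F₂ × ∣ F ∣ ≡ ∣ F₁ ∣ + ∣ F₂ ∣ × P₁ F₁ × P₂ F₂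

    split : ∀ {F P₁ P₂} → F ⊆ X ∪ Y → P₁ (F ∩ X) → P₂ (F ∩ Y) → Split P₁ P₂ F
    split F⊆ p₁ p₂ = let e , s = split-∪ F⊆ in _ , _ , e , s , p₁ , p₂

    split-out : ∀ {F} → Out (X ∪ Y) v F → Split (Out X v) (Sets Y) F
    split-out {F} ((F⊆ , d) , v∉) = split {P₂ = Sets Y} F⊆
      (restrict X d , λ v∈ → v∉ (p∩q⊆p F X v∈)) (restrict Y d)

    split-isolated : ∀ {F} → In⁰ (X ∪ Y) v F → Split (In⁰ X v) (Out Y c) F
    split-isolated {F} ((F⊆ , d) , v∈ , iso) = split {P₁ = In⁰ X v} {P₂ = Out Y c} F⊆
      (restrict X d , ∩-∈ v∈ v∈X , (λ y∈ → iso (p∩q⊆p F X y∈)))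
      (restrict Y d , λ c∈ → iso (p∩q⊆p F Y c∈) v~c)

    -- The case distinction is on the side of the partner of `v`. A partner in `X` excludes `c`,
    -- which would be a second neighbour of `v`. A partner in `Y` must be `c`, and then neither
    -- endpoint has another neighbour in `F`.
    split-matched : ∀ {F} → In¹ (X ∪ Y) v F → Split (In¹ X v) (Out Y c) F ⊎ Split (In⁰ X v) (In⁰ Y c) F
    split-matched {F} ((F⊆ , d) , v∈ , y , y∈ , v~y) with x∈p∪q⁻ X Y (F⊆ y∈)
    ... | inj₁ y∈X = inj₁ (split {P₁ = In¹ X v} {P₂ = Out Y c} F⊆
      (restrict X d , ∩-∈ v∈ v∈X , y , ∩-∈ y∈ y∈X , v~y)
      (restrict Y d , λ c∈ → disjoint y∈X (subst (_∈ Y) (d v∈ (p∩q⊆p F Y c∈) y∈ v~c v~y) c∈Y)))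
    ... | inj₂ y∈Y with edges v∈X y∈Y v~y
    ...   | _ , refl = inj₂ (split {P₁ = In⁰ X v} {P₂ = In⁰ Y c} F⊆
      (restrict X d , ∩-∈ v∈ v∈X , λ z∈ v~z →
        disjoint (p∩q⊆q F X z∈) (subst (_∈ Y) (d v∈ y∈ (p∩q⊆p F X z∈) v~c v~z) c∈Y))
      (restrict Y d , ∩-∈ y∈ c∈Y , λ z∈ c~z →
        disjoint v∈X (subst (_∈ Y) (d y∈ (p∩q⊆p F Y z∈) v∈ c~z (~-sym v~c)) (p∩q⊆q F Y z∈))))

    -- The only edge across is `v ~ c`. If both its ends are chosen, each must be isolated on its
    -- own side, which is what `compatible` supplies.
    union : ∀ {F₁ F₂} → Sets X F₁ → Sets Y F₂ →
            (v ∈ F₁ → c ∈ F₂ → Isolated v F₁ × Isolated c F₂) →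
            Sets (X ∪ Y) (F₁ ∪ F₂) × ∣ F₁ ∪ F₂ ∣ ≡ ∣ F₁ ∣ + ∣ F₂ ∣
    union {F₁} {F₂} (F₁⊆ , d₁) (F₂⊆ , d₂) compatible =
      ((λ x∈ → x∈p∪q⁺ ([ (λ x∈₁ → inj₁ (F₁⊆ x∈₁)) , (λ x∈₂ → inj₂ (F₂⊆ x∈₂)) ]′ (x∈p∪q⁻ F₁ F₂ x∈))) ,
       (λ v∈ a∈ b∈ → d (x∈p∪q⁻ F₁ F₂ v∈) (x∈p∪q⁻ F₁ F₂ a∈) (x∈p∪q⁻ F₁ F₂ b∈))) ,
      disjoint⇒∣p∪q∣≡∣p∣+∣q∣ F₁ F₂ λ x∈₁ x∈₂ → disjoint (F₁⊆ x∈₁) (F₂⊆ x∈₂)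
      where
      cross : ∀ {x y} → x ∈ F₁ → y ∈ F₂ → x ~ y → x ≡ v × y ≡ c × Isolated x F₁ × Isolated y F₂
      cross x∈ y∈ x~y with edges (F₁⊆ x∈) (F₂⊆ y∈) x~y
      ... | refl , refl = refl , refl , compatible x∈ y∈
      d : ∀ {w a b} → w ∈ F₁ ⊎ w ∈ F₂ → a ∈ F₁ ⊎ a ∈ F₂ → b ∈ F₁ ⊎ b ∈ F₂ → w ~ a → w ~ b → a ≡ b
      d (inj₁ w∈) (inj₁ a∈) (inj₁ b∈) w~a w~b = d₁ w∈ a∈ b∈ w~a w~b
      d (inj₁ w∈) (inj₁ a∈) (inj₂ b∈) w~a w~b =
        let _ , _ , iso , _ = cross w∈ b∈ w~b in contradiction w~a (iso a∈)
      d (inj₁ w∈) (inj₂ a∈) (inj₁ b∈) w~a w~b =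
        let _ , _ , iso , _ = cross w∈ a∈ w~a in contradiction w~b (iso b∈)
      d (inj₁ w∈) (inj₂ a∈) (inj₂ b∈) w~a w~b =
        trans (proj₁ (proj₂ (cross w∈ a∈ w~a))) (sym (proj₁ (proj₂ (cross w∈ b∈ w~b))))
      d (inj₂ w∈) (inj₁ a∈) (inj₁ b∈) w~a w~b =
        trans (proj₁ (cross a∈ w∈ (~-sym w~a))) (sym (proj₁ (cross b∈ w∈ (~-sym w~b))))
      d (inj₂ w∈) (inj₁ a∈) (inj₂ b∈) w~a w~b =
        let _ , _ , _ , iso = cross a∈ w∈ (~-sym w~a) in contradiction w~b (iso b∈)
      d (inj₂ w∈) (inj₂ a∈) (inj₁ b∈) w~a w~b =
        let _ , _ , _ , iso = cross b∈ w∈ (~-sym w~b) in contradiction w~a (iso a∈)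
      d (inj₂ w∈) (inj₂ a∈) (inj₂ b∈) w~a w~b = d₂ w∈ a∈ b∈ w~a w~b

  -- `Leads` bounds sizes from above. The `-max` fields supply sets reaching these sizes, which
  -- later identifies the total size at the root with the dissociation number.
  record Counted (X : Subset n) (v : Fin n) (s : State) : Set where
    field
      out-leads      : Leads (Out X v) (out s)
      isolated-leads : Leads (In⁰ X v) (isolated s)
      matched-leads  : Leads (In¹ X v) (matched s)
      out-max        : ∃ λ F → Out X v F × ∣ F ∣ ≡ proj₁ (out s)
      isolated-max   : ∃ λ F → In⁰ X v F × ∣ F ∣ ≡ proj₁ (isolated s)
      -- A single vertex admits no matched set, hence only an inequality.
      matched-max    : ∃ λ F → Sets X F × v ∈ F × proj₁ (matched s) ℕ.≤ ∣ F ∣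

    total-leads : Leads (Sets X) (total s)
    total-leads = leads-⊕ classify (leads-⊕ (λ x → x) out-leads isolated-leads) matched-leads

    total-max : ∃ λ F → Sets X F × proj₁ (total s) ℕ.≤ ∣ F ∣
    total-max with out-max | isolated-max | matched-max
    ... | F , (f , _) , F≡ | H , (h , _) , H≡ | K , k , _ , K≥
      with ℕ.⊔-sel (proj₁ (out s) ⊔ proj₁ (isolated s)) (proj₁ (matched s))
    ...   | inj₂ e = K , k , ℕ.≤-trans (ℕ.≤-reflexive e) K≥
    ...   | inj₁ e with ℕ.⊔-sel (proj₁ (out s)) (proj₁ (isolated s))
    ...     | inj₁ e′ = F , f , ℕ.≤-reflexive (trans e (trans e′ (sym F≡)))
    ...     | inj₂ e′ = H , h , ℕ.≤-reflexive (trans e (trans e′ (sym H≡)))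

  counted-single : ∀ v → Counted ⁅ v ⁆ v leaf
  counted-single v = record
    { out-leads = record
      { bounded = λ o → ℕ.≤-reflexive (trans (cong ∣_∣ (empty o)) (∣⊥∣≡0 n))
      ; list = ⊥ ∷ [] ; short = ℕ.≤-refl
      ; complete = λ o _ → here (empty o) }
    ; isolated-leads = record
      { bounded = λ i → ℕ.≤-reflexive (trans (cong ∣_∣ (full i)) (∣⁅x⁆∣≡1 v))
      ; list = ⁅ v ⁆ ∷ [] ; short = ℕ.≤-refl
      ; complete = λ i _ → here (full i) }
    ; matched-leads = record
      { bounded = λ m → ⊥-elim (unmatched m) 
      ; list = [] ; short = z≤n
      ; complete = λ m _ → ⊥-elim (unmatched m) }
    ; out-max = ⊥ , ((⊥⊆ , λ x∈ → contradiction x∈ ∉⊥) , ∉⊥) , ∣⊥∣≡0 n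
    ; isolated-max = ⁅ v ⁆ , (whole , x∈⁅x⁆ v , λ y∈ v~y → loop y∈ v~y) , ∣⁅x⁆∣≡1 v
    ; matched-max = ⁅ v ⁆ , whole , x∈⁅x⁆ v , z≤n
    }
    where
    loop : ∀ {y} → y ∈ ⁅ v ⁆ → ¬ (v ~ y)
    loop y∈ v~y with x∈⁅y⁆⇒x≡y v y∈
    ... | refl = ~-irr v~y
    whole : Sets ⁅ v ⁆ ⁅ v ⁆
    whole = (λ x∈ → x∈) , λ _ a∈ b∈ _ _ → trans (x∈⁅y⁆⇒x≡y v a∈) (sym (x∈⁅y⁆⇒x≡y v b∈))
    empty : ∀ {F} → Out ⁅ v ⁆ v F → F ≡ ⊥
    empty ((F⊆ , _) , v∉) = ⊆-antisym (λ x∈ → contradiction (subst (_∈ _) (x∈⁅y⁆⇒x≡y v (F⊆ x∈)) x∈) v∉) ⊥⊆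
    full : ∀ {F} → In⁰ ⁅ v ⁆ v F → F ≡ ⁅ v ⁆
    full ((F⊆ , _) , v∈ , _) = ⊆-antisym F⊆ λ x∈ → subst (_∈ _) (sym (x∈⁅y⁆⇒x≡y v x∈)) v∈
    unmatched : ∀ {F} → ¬ In¹ ⁅ v ⁆ v F
    unmatched ((F⊆ , _) , _ , y , y∈ , v~y) = loop (F⊆ y∈) v~y

  counted : ∀ {k v X} (p : Piece k v X) → Counted X v (eval p)
  counted (single v) = counted-single v
  counted (attach {v = v} {X} {c = c} {Y} p q _ disjoint v~c edges) = record
    { out-leads      = leads-⊗ split-out P.out-leads Q.total-leads
    ; isolated-leads = leads-⊗ split-isolated P.isolated-leads Q.out-leads
    ; matched-leads  = leads-⊕ split-matched
        (leads-⊗ (λ x → x) P.matched-leads Q.out-leads)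
        (leads-⊗ (λ x → x) P.isolated-leads Q.isolated-leads)
    ; out-max        = out-max
    ; isolated-max   = isolated-max
    ; matched-max    = matched-max
    }
    where
    module P = Counted (counted p)
    module Q = Counted (counted q)
    open Join disjoint (root∈ p) (root∈ q) v~c edges

    v∉ : ∀ {F₁ F₂} → v ∉ F₁ → F₂ ⊆ Y → v ∉ F₁ ∪ F₂
    v∉ {F₁} {F₂} v∉₁ F₂⊆ v∈ = [ v∉₁ , (λ v∈₂ → disjoint (root∈ p) (F₂⊆ v∈₂)) ]′ (x∈p∪q⁻ F₁ F₂ v∈)

    total-size : ∃ λ F → Sets Y F × ∣ F ∣ ≡ proj₁ (total (eval q))
    total-size with Q.total-max
    ... | F , f , ≥ = F , f , ℕ.≤-antisym (Leads.bounded Q.total-leads f) ≥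

    out-max : ∃ λ F → Out (X ∪ Y) v F × ∣ F ∣ ≡ proj₁ (out (eval p)) + proj₁ (total (eval q))
    out-max with P.out-max | total-size
    ... | F , (f , v∉F) , F≡ | H , h , H≡ with union f h (λ v∈ _ → contradiction v∈ v∉F)
    ...   | u , e = F ∪ H , (u , v∉ v∉F (proj₁ h)) , trans e (cong₂ _+_ F≡ H≡)

    isolated-max : ∃ λ F → In⁰ (X ∪ Y) v F × ∣ F ∣ ≡ proj₁ (isolated (eval p)) + proj₁ (out (eval q))
    isolated-max with P.isolated-max | Q.out-max
    ... | F , (f , v∈F , iso) , F≡ | H , (h , c∉H) , H≡ with union f h (λ _ c∈ → contradiction c∈ c∉H)
    ...   | u , e = F ∪ H , (u , p⊆p∪q H v∈F , iso′) , trans e (cong₂ _+_ F≡ H≡)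
      where
      iso′ : Isolated v (F ∪ H)
      iso′ y∈ v~y with x∈p∪q⁻ F H y∈
      ... | inj₁ y∈F = iso y∈F v~y
      ... | inj₂ y∈H with edges (root∈ p) (proj₁ h y∈H) v~y
      ...   | _ , refl = c∉H y∈H

    matched-max : ∃ λ F → Sets (X ∪ Y) F × v ∈ F ×
      (proj₁ (matched (eval p)) + proj₁ (out (eval q))) ⊔
      (proj₁ (isolated (eval p)) + proj₁ (isolated (eval q))) ℕ.≤ ∣ F ∣
    matched-max with ℕ.⊔-sel (proj₁ (matched (eval p)) + proj₁ (out (eval q)))
                             (proj₁ (isolated (eval p)) + proj₁ (isolated (eval q)))
    ... | inj₁ max≡ with P.matched-max | Q.out-max
    ...   | F , f , v∈F , F≥ | H , (h , c∉H) , H≡ with union f h (λ _ c∈ → contradiction c∈ c∉H)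
    ...     | u , e = F ∪ H , u , p⊆p∪q H v∈F ,
      ℕ.≤-trans (ℕ.≤-reflexive max≡)
        (ℕ.≤-trans (ℕ.+-mono-≤ F≥ (ℕ.≤-reflexive (sym H≡))) (ℕ.≤-reflexive (sym e)))
    matched-max | inj₂ max≡ with P.isolated-max | Q.isolated-max
    ...   | F , (f , v∈F , iso) , F≡ | H , (h , c∈H , iso′) , H≡ with union f h (λ _ _ → iso , iso′)
    ...     | u , e = F ∪ H , u , p⊆p∪q H v∈F ,
      ℕ.≤-reflexive (trans max≡ (trans (cong₂ _+_ (sym F≡) (sym H≡)) (sym e)))

-- Normalised bounds and their behaviour under joining.

truncate-shift : ∀ k {M m N} → truncate (k + M) (k + m , N) ≡ truncate M (m , N)
truncate-shift zero    = refl
truncate-shift (suc k) = truncate-shift k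

truncate-≡ : ∀ m {N} → truncate m (m , N) ≡ N
truncate-≡ zero    = refl
truncate-≡ (suc m) = truncate-≡ m

truncate-≢ : ∀ {M m N} → m ≢ M → truncate M (m , N) ≡ 0
truncate-≢ {M} {m} m≢M with m ≡ᵇ M in eq
... | false = refl
... | true  = contradiction (ℕ.≡ᵇ⇒≡ m M (subst T (sym eq) tt)) m≢M

-- `V` is in units finer by the factor `t` than those of `W`; `j` is the difference of the two base
-- sizes.
covered : (t j : ℕ) → Lead → Lead → Bool
covered t j (m , V) (a , W) = (m ≡ᵇ j + a) ∧ (V ≤ᵇ t * W)

coveredView : ℕ → View → View → Bool
coveredView t (x , y , z) (x′ , y′ , z′) = covered t j x x′ ∧ covered t j y y′ ∧ covered t j z z′
  -- One shift serves all three leads. If the subtraction truncates, the size test on the first lead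
  -- fails, so the check stays sound.
  where j = proj₁ x ∸ proj₁ x′

-- AtMost s n m N V encodes N ≤ (V / s) (p / q)^(4 n − 5 m), cleared of denominators; an approximation of
-- the lead (m , N) of a piece of order n is a pair (m − k , V) with this property.
module Weighted (p q : ℕ) where

  -- The quotient `gain m n` / `loss m n` is (p / q)^(5m - 4n), split so that all exponents are
  -- natural.
  gain loss : ℕ → ℕ → ℕ
  gain m n = p ℕ.^ (5 * m) * q ℕ.^ (4 * n)
  loss m n = q ℕ.^ (5 * m) * p ℕ.^ (4 * n)

  swap : ∀ a b c d → (a * b) * (c * d) ≡ (a * c) * (b * d)
  swap = solve-∀

  ^-split : ∀ a c m m′ → a ℕ.^ (c * (m + m′)) ≡ a ℕ.^ (c * m) * a ℕ.^ (c * m′)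
  ^-split a c m m′ = trans (cong (a ℕ.^_) (ℕ.*-distribˡ-+ c m m′)) (ℕ.^-distribˡ-+-* a (c * m) (c * m′))

  weight-+ : ∀ a b m n m′ n′ → a ℕ.^ (5 * (m + m′)) * b ℕ.^ (4 * (n + n′)) ≡
             (a ℕ.^ (5 * m) * b ℕ.^ (4 * n)) * (a ℕ.^ (5 * m′) * b ℕ.^ (4 * n′))
  weight-+ a b m n m′ n′ = trans (cong₂ _*_ (^-split a 5 m m′) (^-split b 4 n n′))
    (swap (a ℕ.^ (5 * m)) (a ℕ.^ (5 * m′)) (b ℕ.^ (4 * n)) (b ℕ.^ (4 * n′)))

  record AtMost (s n m N V : ℕ) : Set where
    constructor atMost
    field bound : N * (gain m n * s) ℕ.≤ V * loss m n

  record Approx (s n k : ℕ) (x y : Lead) : Set where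
    constructor approx
    field
      shifted : proj₁ x ≡ k + proj₁ y
      bounded : AtMost s n (proj₁ x) (proj₂ x) (proj₂ y)

  approx-⊗ : ∀ {s n k x y s′ n′ k′ x′ y′} → Approx s n k x y → Approx s′ n′ k′ x′ y′ →
             Approx (s * s′) (n + n′) (k + k′) (x ⊗ x′) (y ⊗ y′)
  approx-⊗ {s} {n} {k} {m , N} {a , V} {s′} {n′} {k′} {m′ , N′} {a′ , V′}
           (approx e (atMost b)) (approx e′ (atMost b′)) = approx
    (trans (cong₂ _+_ e e′) (+-swap k a k′ a′))
    (atMost (begin
      N * N′ * (gain (m + m′) (n + n′) * (s * s′))
        ≡⟨ cong (λ g → N * N′ * (g * (s * s′))) (weight-+ p q m n m′ n′) ⟩
      N * N′ * (gain m n * gain m′ n′ * (s * s′))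
        ≡⟨ cong (N * N′ *_) (swap (gain m n) (gain m′ n′) s s′) ⟩
      N * N′ * (gain m n * s * (gain m′ n′ * s′))
        ≡⟨ swap N N′ (gain m n * s) (gain m′ n′ * s′) ⟩
      N * (gain m n * s) * (N′ * (gain m′ n′ * s′))
        ≤⟨ ℕ.*-mono-≤ b b′ ⟩
      V * loss m n * (V′ * loss m′ n′)
        ≡⟨ swap V (loss m n) V′ (loss m′ n′) ⟩
      V * V′ * (loss m n * loss m′ n′)
        ≡⟨ cong (V * V′ *_) (weight-+ q p m n m′ n′) ⟨
      V * V′ * loss (m + m′) (n + n′) ∎))
    where
    open ℕ.≤-Reasoning
    +-swap : ∀ a b c d → (a + b) + (c + d) ≡ (a + c) + (b + d)
    +-swap = solve-∀

  truncate-atMost : ∀ {s n k x y M} → Approx s n k x y →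
                    AtMost s n (k + M) (truncate (k + M) x) (truncate M y)
  truncate-atMost {s} {n} {k} {x = _ , N} {a , V} {M} (approx refl b)
    rewrite truncate-shift k {M} {a} {N} with a ℕ.≟ M
  ... | yes refl rewrite truncate-≡ a {N} | truncate-≡ a {V} = b
  ... | no  a≢M  rewrite truncate-≢ {M} {a} {N} a≢M = atMost z≤n

  -- Both exact sizes exceed the approximate ones by the same `k`, so `⊕` discards the same summand
  -- on either side.
  approx-⊕ : ∀ {s n k x y x′ y′} → Approx s n k x y → Approx s n k x′ y′ → Approx s n k (x ⊕ x′) (y ⊕ y′)
  approx-⊕ {s} {n} {k} {x} {a , V} {x′} {a′ , V′} X@(approx e _) X′@(approx e′ _) =
    approx M≡ (subst (λ L → AtMost s n L (truncate L x + truncate L x′) (V↓ + V′↓)) (sym M≡) sum)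
    where
    M = a ⊔ a′
    V↓ = truncate M (a , V)
    V′↓ = truncate M (a′ , V′)
    M≡ : proj₁ x ⊔ proj₁ x′ ≡ k + M
    M≡ = trans (cong₂ _⊔_ e e′) (sym (ℕ.+-distribˡ-⊔ k a a′))
    sum : AtMost s n (k + M) (truncate (k + M) x + truncate (k + M) x′) (V↓ + V′↓)
    sum = atMost (subst₂ ℕ._≤_
      (sym (ℕ.*-distribʳ-+ (gain (k + M) n * s) (truncate (k + M) x) (truncate (k + M) x′)))
      (sym (ℕ.*-distribʳ-+ (loss (k + M) n) V↓ V′↓))
      (ℕ.+-mono-≤ (AtMost.bound (truncate-atMost X)) (AtMost.bound (truncate-atMost X′))))

  record ApproxView (s n k : ℕ) (v w : View) : Set where
    constructor approxView
    field
      out-approx      : Approx s n k (proj₁ v) (proj₁ w)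
      isolated-approx : Approx s n k (proj₁ (proj₂ v)) (proj₁ (proj₂ w))
      total-approx    : Approx s n k (proj₂ (proj₂ v)) (proj₂ (proj₂ w))

  record ApproxState (s n k : ℕ) (x y : State) : Set where
    constructor approxState
    field
      out-approx      : Approx s n k (out x) (out y)
      isolated-approx : Approx s n k (isolated x) (isolated y)
      matched-approx  : Approx s n k (matched x) (matched y)

    total-approx : Approx s n k (total x) (total y)
    total-approx = approx-⊕ (approx-⊕ out-approx isolated-approx) matched-approx

    view-approx : ApproxView s n k (toView x) (toView y)
    view-approx = approxView out-approx isolated-approx total-approx

  approx-◂ : ∀ {s n k x y s′ n′ k′ v w} → ApproxState s n k x y → ApproxView s′ n′ k′ v w →
             ApproxState (s * s′) (n + n′) (k + k′) (x ◂ v) (y ◂ w)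
  approx-◂ (approxState o i m) (approxView o′ i′ t′) =
    approxState (approx-⊗ o t′) (approx-⊗ i o′) (approx-⊕ (approx-⊗ m o′) (approx-⊗ i i′))

  atMost-rescale : ∀ {s t n m N V W} .{{_ : NonZero t}} →
                   AtMost (s * t) n m N V → V ℕ.≤ t * W → AtMost s n m N W
  atMost-rescale {s} {t} {n} {m} {N} {V} {W} (atMost b) V≤ = atMost (ℕ.*-cancelˡ-≤ t (begin
    t * (N * (gain m n * s)) ≡⟨ rearrange t N (gain m n) s ⟩
    N * (gain m n * (s * t)) ≤⟨ b ⟩
    V * loss m n             ≤⟨ ℕ.*-monoˡ-≤ (loss m n) V≤ ⟩
    t * W * loss m n         ≡⟨ ℕ.*-assoc t W (loss m n) ⟩
    t * (W * loss m n)       ∎))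
    where
    open ℕ.≤-Reasoning
    rearrange : ∀ t N g s → t * (N * (g * s)) ≡ N * (g * (s * t))
    rearrange = solve-∀

  approx-covered : ∀ {s t j n k x y z} .{{_ : NonZero t}} →
                   Approx (s * t) n k x y → T (covered t j y z) → Approx s n (k + j) x z
  approx-covered {t = t} {j} {k = k} {y = a , V} {c , W} (approx e b) h
    with Equivalence.to (T-∧ {a ≡ᵇ j + c}) h
  ... | a≡ , V≤ = approx
    (trans e (trans (cong (λ x → k + x) (ℕ.≡ᵇ⇒≡ a (j + c) a≡)) (sym (ℕ.+-assoc k j c))))
    (atMost-rescale b (ℕ.≤ᵇ⇒≤ V (t * W) V≤))

  approx-coveredView : ∀ {s t n k v w z} .{{_ : NonZero t}} →
                       ApproxView (s * t) n k v w → T (coveredView t w z) → ∃ λ j → ApproxView s n j v z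
  approx-coveredView {t = t} {w = x , y , _} {x′ , y′ , _} (approxView o i a) h
    with Equivalence.to (T-∧ {covered t (proj₁ x ∸ proj₁ x′) x x′}) h
  ... | h₁ , h′ with Equivalence.to (T-∧ {covered t (proj₁ x ∸ proj₁ x′) y y′}) h′
  ...   | h₂ , h₃ = _ , approxView (approx-covered o h₁) (approx-covered i h₂) (approx-covered a h₃)

-- The invariant carried by a closed table.

-- Approximations, at scale D^(k+1), of the pieces whose root has k children.
states : State → List View → ℕ → List State
states seed table zero    = seed ∷ []
states seed table (suc k) = cartesianProductWith _◂_ (states seed table k) table

-- The factor `D ℕ.^ k` levels the scale D^(k+1) of a state against the scale D of the rows.
inTable : ℕ → List View → ℕ → State → Bool
inTable D table k s = any (coveredView (D ℕ.^ k) (toView s)) table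

small : ℕ → ℕ → ℕ → State → Bool
small D top k s = proj₂ (total s) ≤ᵇ D ℕ.^ k * top

-- Closure is asked for k ≤ 2, since attached branches have at most two children; the final bound
-- for k ≤ 3, the most children the root of the tree can have.
module Invariant (p q D top : ℕ) (D≢0 : NonZero D) (seed : State) (table : List View)
  (seeded : Weighted.ApproxState p q (D ℕ.^ 1) 1 0 leaf seed)
  (closed : ∀ {k} → k ℕ.≤ 2 → T (all (inTable D table k) (states seed table k)))
  (bounded : ∀ {k} → k ℕ.≤ 3 → T (all (small D top k) (states seed table k)))
  {n : ℕ} (G : Graph n) where

  open Weighted p q
  open Structure G
  open Counting G

  approximated : ∀ {k v X} (P : Piece k v X) →
    ∃ λ s → s ∈ᴸ states seed table k × (∃ λ b → ApproxState (D ℕ.^ suc k) ∣ X ∣ b (eval P) s)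
  approximated (single v) rewrite ∣⁅x⁆∣≡1 v = _ , here refl , 0 , seeded
  approximated (attach {k} {X = X} {l} {Y = Y} P Q l≤2 disjoint v~c edges)
    with approximated P | approximated Q
  ... | s , s∈ , b , S | t , t∈ , c , T
    -- The state of the child is replaced by a row `w` covering it. This returns to scale `D`, so
    -- joining multiplies the scale by just one more `D`.
    with find (any⁻ _ table (All.lookup (all⁺ (inTable D table l) (states seed table l) (closed l≤2)) t∈))
  ...   | w , w∈ , h
    with approx-coveredView {s = D} {t = D ℕ.^ l} {{ℕ.m^n≢0 D l {{D≢0}}}} (ApproxState.view-approx T) h
  ...     | d , W rewrite disjoint⇒∣p∪q∣≡∣p∣+∣q∣ X Y disjoint =
    s ◂ w , ∈-cartesianProductWith⁺ _◂_ s∈ w∈ , b + d ,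
    subst (λ r → ApproxState r (∣ X ∣ + ∣ Y ∣) (b + d) (eval P ◂ toView (eval Q)) (s ◂ w))
      (ℕ.*-comm (D ℕ.^ suc k) D) (approx-◂ S W)

  total-bound : ∀ {k v X} (P : Piece k v X) → k ℕ.≤ 3 →
                AtMost D ∣ X ∣ (proj₁ (total (eval P))) (proj₂ (total (eval P))) top
  total-bound {k} {X = X} P k≤3 with approximated P
  ... | s , s∈ , b , S = atMost-rescale {{ℕ.m^n≢0 D k {{D≢0}}}}
    (Approx.bounded (ApproxState.total-approx S))
    (ℕ.≤ᵇ⇒≤ (proj₂ (total s)) (D ℕ.^ k * top)
      (All.lookup (all⁺ (small D top k) (states seed table k) (bounded k≤3)) s∈))

-- The table for β = 1.466.

-- Bounds are in units of 1 / D, which makes β⁻⁴, …, β² integral; extremal trees attain some of these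
-- powers, which therefore cannot be rounded.
D : ℕ
D = 1000 ℕ.^ 2 * 1466 ℕ.^ 4

β⁻⁴ β⁻³ β⁻² β⁻¹ β⁰ β¹ β² : ℕ
β⁻⁴ = 1000 ℕ.^ 6
β⁻³ = 1466 ℕ.^ 1 * 1000 ℕ.^ 5
β⁻² = 1466 ℕ.^ 2 * 1000 ℕ.^ 4
β⁻¹ = 1466 ℕ.^ 3 * 1000 ℕ.^ 3
β⁰  = D
β¹  = 1466 ℕ.^ 5 * 1000 ℕ.^ 1
β²  = 1466 ℕ.^ 6

infix 9 _‰

-- `c ‰` stands for the bound c / 1000, since `D` is 1000 times 1466^4 * 1000.
_‰ : ℕ → ℕ
c ‰ = c * (1466 ℕ.^ 4 * 1000)

-- Obtained by a computer search: starting from all undominated bounds, rows were merged as long as the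
-- table stayed closed and the final bound survived. The first components are the maximum sizes relative
-- to a common base.
table : List View
table =
  ((0 , 425 ‰) , (1 , β⁻²) , (1 , 1053 ‰)) ∷
  ((0 , 404 ‰) , (1 , β⁻¹) , (1 , 954 ‰)) ∷
  ((0 , 384 ‰) , (1 , 624 ‰) , (1 , 1185 ‰)) ∷
  ((0 , 304 ‰) , (1 , β⁻¹) , (1 , 1423 ‰)) ∷
  ((0 , 296 ‰) , (1 , β⁰) , (1 , 1398 ‰)) ∷
  ((0 , β⁻⁴) , (1 , β¹) , (1 , β¹)) ∷
  ((0 , 445 ‰) , (0 , 304 ‰) , (1 , β⁰)) ∷
  ((0 , 434 ‰) , (0 , β⁻⁴) , (1 , β¹)) ∷
  ((0 , 360 ‰) , (0 , 446 ‰) , (1 , β⁰)) ∷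
  ((0 , β⁻³) , (0 , β⁻³) , (1 , β²)) ∷
  ((0 , 303 ‰) , (0 , 434 ‰) , (1 , β¹)) ∷
  ((0 , 257 ‰) , (0 , 563 ‰) , (1 , 915 ‰)) ∷
  ((0 , 228 ‰) , (0 , 624 ‰) , (1 , β⁻¹)) ∷
  ((0 , 207 ‰) , (0 , 593 ‰) , (1 , β⁰)) ∷
  ((1 , β⁰) , (0 , 148 ‰) , (1 , β⁰)) ∷
  ((1 , β⁻¹) , (0 , 202 ‰) , (1 , 1365 ‰)) ∷
  ((1 , β⁻²) , (0 , 291 ‰) , (1 , 1400 ‰)) ∷
  ((0 , 652 ‰) , (0 , β⁻⁴) , (0 , 1306 ‰)) ∷
  ((0 , 636 ‰) , (0 , β⁻³) , (0 , 1270 ‰)) ∷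
  ((0 , 620 ‰) , (0 , 289 ‰) , (0 , 1331 ‰)) ∷
  ((0 , 608 ‰) , (0 , 304 ‰) , (0 , 1331 ‰)) ∷
  ((0 , β⁻²) , (0 , β⁻²) , (0 , 1396 ‰)) ∷
  ((0 , β⁻³) , (0 , 653 ‰) , (0 , 1401 ‰)) ∷
  []

-- For order 1 the weight β^(5m - 4) is β⁻⁴ at size 0 and β at size 1.
seed : State
seed = state (0 , β⁻⁴) (1 , β¹) (0 , 0)

seeded : Weighted.ApproxState 1466 1000 (D ℕ.^ 1) 1 0 leaf seed
seeded = approxState (approx refl (atMost (ℕ.≤ᵇ⇒≤ _ _ _))) (approx refl (atMost (ℕ.≤ᵇ⇒≤ _ _ _)))
                     (approx refl (atMost z≤n))
  where open Weighted 1466 1000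

-- Evaluation of the check on 1, 23 and 23^2 states, one choice of row per child; once it reduces to
-- `true`, the goal is the unit type.
table-closed : ∀ {k} → k ℕ.≤ 2 → T (all (inTable D table k) (states seed table k))
table-closed z≤n             = _
table-closed (s≤s z≤n)       = _
table-closed (s≤s (s≤s z≤n)) = _

table-bounded : ∀ {k} → k ℕ.≤ 3 → T (all (small D β² k) (states seed table k))
table-bounded z≤n                   = _
table-bounded (s≤s z≤n)             = _
table-bounded (s≤s (s≤s z≤n))       = _
table-bounded (s≤s (s≤s (s≤s z≤n))) = _

-- Identification of the root total with `ψ` and `Φ`.

unique-⊆⇒length≤ : ∀ {A : Set} {xs ys : List A} →
                    Unique xs → (∀ {x} → x ∈ᴸ xs → x ∈ᴸ ys) → length xs ℕ.≤ length ys
unique-⊆⇒length≤ [] _ = z≤n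
unique-⊆⇒length≤ {xs = x ∷ xs} (x∉ ∷ u) xs⊆ys with ∈-∃++ (xs⊆ys (here refl))
... | as , bs , refl = subst (suc (length xs) ℕ.≤_) length≡ (s≤s (unique-⊆⇒length≤ u rest))
  where
  length≡ : suc (length (as ++ bs)) ≡ length (as ++ x ∷ bs)
  length≡ = trans (cong suc (length-++ as)) (sym (trans (length-++ as) (ℕ.+-suc (length as) (length bs))))
  rest : ∀ {y} → y ∈ᴸ xs → y ∈ᴸ as ++ bs
  rest y∈ with ∈-++⁻ as (xs⊆ys (there y∈))
  ... | inj₁ y∈as          = ∈-++⁺ˡ y∈as
  ... | inj₂ (here refl)   = contradiction refl (All.lookup x∉ y∈)
  ... | inj₂ (there y∈bs)  = ∈-++⁺ʳ as y∈bs

module _ {n : ℕ} (G : Graph n) where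
  open Structure G
  open Counting G

  private
    module Whole {k v} (P : Piece k v ⊤) where
      open Counted (counted P)
      open Leads total-leads

      m N : ℕ
      m = proj₁ (total (eval P))
      N = proj₂ (total (eval P))

      dissociation≤m : ∀ F → IsDissociationSet G F → ∣ F ∣ ℕ.≤ m
      dissociation≤m F d = bounded (⊆⊤ , dissociated⁺ d)

      -- `total-max` provides a dissociation set of size at least `m`, and none is larger than `m`;
      -- so it is maximum and its size is `ψ G`.
      m≡ψ : m ≡ ψ G
      m≡ψ with total-max
      ... | F , f@(_ , d) , m≤ = trans (ℕ.≤-antisym m≤ (bounded f))
        (maximum⇒∣F∣≡ψ G (dissociated⁻ d , λ F′ d′ → ℕ.≤-trans (dissociation≤m F′ d′) m≤))

      -- The enumeration behind `Φ` has no repetitions, and each of its sets has size `ψ G`, that is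
      -- `m`, hence occurs in `list`.
      Φ≤N : Φ G ℕ.≤ N
      Φ≤N = ℕ.≤-trans
        (unique-⊆⇒length≤ (Unique.filter⁺ (isMaximumDissociationSet? G) (subsets-unique n)) listed) short
        where
        listed : ∀ {F} → F ∈ᴸ filter (isMaximumDissociationSet? G) (subsets n) → F ∈ᴸ list
        listed F∈ with ∈-filter⁻ (isMaximumDissociationSet? G) {xs = subsets n} F∈
        ... | _ , max@(d , _) = complete (⊆⊤ , dissociated⁺ d) (trans (maximum⇒∣F∣≡ψ G max) (sym m≡ψ))

  open Whole public using () renaming (m≡ψ to total-size≡ψ; Φ≤N to Φ≤total-count)

-- Passage to rational powers with integer exponent.

ι : ℕ → ℚ
ι x = (+ x) / 1

toℚᵘ-ι : ∀ x → ℚ.toℚᵘ (ι x) ℚᵘ.≃ mkℚᵘ (+ x) 0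
toℚᵘ-ι x = ℚ.toℚᵘ-fromℚᵘ (mkℚᵘ (+ x) 0)

ι-* : ∀ x y → ι (x * y) ≡ ι x ℚ.* ι y
ι-* x y = ℚ.toℚᵘ-injective (ℚᵘ.≃-trans (toℚᵘ-ι (x * y))
  (ℚᵘ.≃-trans (*≡* (cong (ℤ._* + 1) (ℤ.pos-* x y)))
  (ℚᵘ.≃-trans (ℚᵘ.*-cong (ℚᵘ.≃-sym (toℚᵘ-ι x)) (ℚᵘ.≃-sym (toℚᵘ-ι y)))
  (ℚᵘ.≃-sym (ℚ.toℚᵘ-homo-* (ι x) (ι y))))))

ι-mono-≤ : ∀ {x y} → x ℕ.≤ y → ι x ≤ ι y
ι-mono-≤ {x} {y} x≤y = ℚ.toℚᵘ-cancel-≤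
  (ℚᵘ.≤-respʳ-≃ (ℚᵘ.≃-sym (toℚᵘ-ι y)) (ℚᵘ.≤-respˡ-≃ (ℚᵘ.≃-sym (toℚᵘ-ι x))
    (*≤* (ℤ.*-monoʳ-≤-nonNeg (+ 1) (ℤ.+≤+ x≤y)))))

ι-^ : ∀ x k → ι (x ℕ.^ k) ≡ ι x ^ℕ k
ι-^ x zero    = refl
ι-^ x (suc k) = trans (ι-* x (x ℕ.^ k)) (cong (ι x ℚ.*_) (ι-^ x k))

^ℕ-distrib-* : ∀ x y k → (x ℚ.* y) ^ℕ k ≡ x ^ℕ k ℚ.* y ^ℕ k
^ℕ-distrib-* x y zero    = refl
^ℕ-distrib-* x y (suc k) = trans (cong (x ℚ.* y ℚ.*_) (^ℕ-distrib-* x y k))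
  (interchange x y (x ^ℕ k) (y ^ℕ k))

1^ℕ : ∀ k → 1ℚ ^ℕ k ≡ 1ℚ
1^ℕ zero    = refl
1^ℕ (suc k) = trans (ℚ.*-identityˡ (1ℚ ^ℕ k)) (1^ℕ k)

^ℕ-positive : ∀ x k → Positive x → Positive (x ^ℕ k)
^ℕ-positive x zero    _   = _
^ℕ-positive x (suc k) pos = ℚ.pos*pos⇒pos x {{pos}} (x ^ℕ k) {{^ℕ-positive x k pos}}

-- Multiplying by `q ^ℕ b` clears the possibly negative exponent, so later arguments need not
-- distinguish its sign.
^-⊖ : ∀ q .{{_ : ℚ.NonZero q}} a b → q ^ (a ⊖ b) ℚ.* q ^ℕ b ≡ q ^ℕ a
^-⊖ q a       zero    = ℚ.*-identityʳ (q ^ℕ a)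
^-⊖ q zero    (suc b) = trans (sym (^ℕ-distrib-* (1/ q) q (suc b)))
  (trans (cong (_^ℕ suc b) (ℚ.*-inverseˡ q)) (1^ℕ (suc b)))
^-⊖ q (suc a) (suc b) rewrite ℤ.[1+m]⊖[1+n]≡m⊖n a b =
  trans (x∙yz≈y∙xz (q ^ (a ⊖ b)) q (q ^ℕ b)) (cong (q ℚ.*_) (^-⊖ q a b))

exponent : ∀ n m → (+ 4) ℤ.* (+ n) ℤ.- (+ 5) ℤ.* (+ m) ℤ.+ (+ 2) ≡ (4 * n + 2) ⊖ (5 * m)
exponent n m rewrite sym (ℤ.pos-* 4 n) | sym (ℤ.pos-* 5 m) | ℤ.[+m]-[+n]≡m⊖n (4 * n) (5 * m) =
  ℤ.distribˡ-⊖-+-pos 2 (4 * n) (5 * m)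

-- Both sides are compared after multiplication by r^b d^(b+a), where r = c / d.
ι≤^-⊖ : ∀ c d r .{{_ : ℚ.NonZero r}} → Positive r → Positive (ι d) → r ℚ.* ι d ≡ ι c →
        ∀ a b N → N * (c ℕ.^ b * d ℕ.^ a) ℕ.≤ c ℕ.^ a * d ℕ.^ b → ι N ≤ r ^ (a ⊖ b)
ι≤^-⊖ c d r r>0 d>0 rd≡c a b N N≤ = ℚ.*-cancelʳ-≤-pos scale {{scale>0}} (subst₂ _≤_ left right (ι-mono-≤ N≤))
  where
  scale : ℚ
  scale = r ^ℕ b ℚ.* (ι d ^ℕ b ℚ.* ι d ^ℕ a)
  scale>0 : Positive scale
  scale>0 = ℚ.pos*pos⇒pos (r ^ℕ b) {{^ℕ-positive r b r>0}} (ι d ^ℕ b ℚ.* ι d ^ℕ a)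
    {{ℚ.pos*pos⇒pos (ι d ^ℕ b) {{^ℕ-positive (ι d) b d>0}} (ι d ^ℕ a) {{^ℕ-positive (ι d) a d>0}}}}
  power : ∀ k → ι (c ℕ.^ k) ≡ r ^ℕ k ℚ.* ι d ^ℕ k
  power k = trans (ι-^ c k) (trans (cong (_^ℕ k) (sym rd≡c)) (^ℕ-distrib-* r (ι d) k))
  open ≡-Reasoning
  left : ι (N * (c ℕ.^ b * d ℕ.^ a)) ≡ ι N ℚ.* scale
  left = begin
    ι (N * (c ℕ.^ b * d ℕ.^ a))
      ≡⟨ ι-* N _ ⟩
    ι N ℚ.* ι (c ℕ.^ b * d ℕ.^ a)
      ≡⟨ cong (ι N ℚ.*_) (ι-* (c ℕ.^ b) (d ℕ.^ a)) ⟩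
    ι N ℚ.* (ι (c ℕ.^ b) ℚ.* ι (d ℕ.^ a))
      ≡⟨ cong (ι N ℚ.*_) (cong₂ ℚ._*_ (power b) (ι-^ d a)) ⟩
    ι N ℚ.* (r ^ℕ b ℚ.* ι d ^ℕ b ℚ.* ι d ^ℕ a)
      ≡⟨ cong (ι N ℚ.*_) (ℚ.*-assoc (r ^ℕ b) (ι d ^ℕ b) (ι d ^ℕ a)) ⟩
    ι N ℚ.* scale ∎
  right : ι (c ℕ.^ a * d ℕ.^ b) ≡ r ^ (a ⊖ b) ℚ.* scale
  right = begin
    ι (c ℕ.^ a * d ℕ.^ b)
      ≡⟨ ι-* (c ℕ.^ a) (d ℕ.^ b) ⟩
    ι (c ℕ.^ a) ℚ.* ι (d ℕ.^ b)
      ≡⟨ cong₂ ℚ._*_ (power a) (ι-^ d b) ⟩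
    r ^ℕ a ℚ.* ι d ^ℕ a ℚ.* ι d ^ℕ b
      ≡⟨ ℚ.*-assoc (r ^ℕ a) (ι d ^ℕ a) (ι d ^ℕ b) ⟩
    r ^ℕ a ℚ.* (ι d ^ℕ a ℚ.* ι d ^ℕ b)
      ≡⟨ cong₂ ℚ._*_ (sym (^-⊖ r a b)) (ℚ.*-comm (ι d ^ℕ a) (ι d ^ℕ b)) ⟩
    r ^ (a ⊖ b) ℚ.* r ^ℕ b ℚ.* (ι d ^ℕ b ℚ.* ι d ^ℕ a)
      ≡⟨ ℚ.*-assoc (r ^ (a ⊖ b)) (r ^ℕ b) _ ⟩
    r ^ (a ⊖ b) ℚ.* scale ∎

-- The final bound over the scale is p^2 c / (q^2 c) = r^2, which accounts for the 2 in the
-- exponent; the common factor `c` cancels.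
atMost⇒ι≤ : ∀ p q c .{{_ : NonZero c}} r .{{_ : ℚ.NonZero r}} →
            Positive r → Positive (ι q) → r ℚ.* ι q ≡ ι p →
            ∀ {n m N} → Weighted.AtMost p q (q ℕ.^ 2 * c) n m N (p ℕ.^ 2 * c) →
            ι N ≤ r ^ ((4 * n + 2) ⊖ (5 * m))
atMost⇒ι≤ p q c r r>0 q>0 rq≡p {n} {m} {N} (Weighted.atMost b) =
  ι≤^-⊖ p q r r>0 q>0 rq≡p (4 * n + 2) (5 * m) N (ℕ.*-cancelʳ-≤ _ _ c (subst₂ ℕ._≤_ left right b))
  where
  left′ : ∀ N g h s c → N * (g * h * (s * c)) ≡ N * (g * (h * s)) * c
  left′ = solve-∀
  left : N * (p ℕ.^ (5 * m) * q ℕ.^ (4 * n) * (q ℕ.^ 2 * c)) ≡ N * (p ℕ.^ (5 * m) * q ℕ.^ (4 * n + 2)) * c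
  left = trans (left′ N (p ℕ.^ (5 * m)) (q ℕ.^ (4 * n)) (q ℕ.^ 2) c)
    (cong (λ h → N * (p ℕ.^ (5 * m) * h) * c) (sym (ℕ.^-distribˡ-+-* q (4 * n) 2)))
  right′ : ∀ s c g h → s * c * (g * h) ≡ h * s * g * c
  right′ = solve-∀
  right : p ℕ.^ 2 * c * (q ℕ.^ (5 * m) * p ℕ.^ (4 * n)) ≡ p ℕ.^ (4 * n + 2) * q ℕ.^ (5 * m) * c
  right = trans (right′ (p ℕ.^ 2) c (q ℕ.^ (5 * m)) (p ℕ.^ (4 * n)))
    (cong (λ h → h * q ℕ.^ (5 * m) * c) (sym (ℕ.^-distribˡ-+-* p (4 * n) 2)))

tree-bound : ∀ p q c .{{_ : NonZero c}} r .{{_ : ℚ.NonZero r}} →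
  Positive r → Positive (ι q) → r ℚ.* ι q ≡ ι p →
  ∀ {n} (T : Graph n) → let open Structure T; open Counting T in
  (∀ {k v X} (P : Piece k v X) → k ℕ.≤ 3 →
    Weighted.AtMost p q (q ℕ.^ 2 * c) ∣ X ∣ (proj₁ (total (eval P))) (proj₂ (total (eval P))) (p ℕ.^ 2 * c)) →
  Graph.IsTree T → Graph.Subcubic T →
  ι (Φ T) ≤ r ^ ((+ 4) ℤ.* (+ n) ℤ.- (+ 5) ℤ.* (+ ψ T) ℤ.+ (+ 2))
tree-bound p q c r r>0 q>0 rq≡p {n} T total-bound tree subcubic =
  subst (λ e → ι (Φ T) ≤ r ^ e) (sym (exponent n (ψ T)))
    (ℚ.≤-trans (ι-mono-≤ (Φ≤total-count T P)) (atMost⇒ι≤ p q c r r>0 q>0 rq≡p atMost))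
  where
  open Graph.IsTree tree
  decomposed = Structure.decomposition T acyclic subcubic connected (fromℕ< nonEmpty)
  k≤3 = proj₁ (proj₂ decomposed)
  P   = proj₂ (proj₂ decomposed)
  N : ℕ
  N = proj₂ (total (Counting.eval T P))
  atMost : Weighted.AtMost p q (q ℕ.^ 2 * c) n (ψ T) N (p ℕ.^ 2 * c)
  atMost = subst₂ (λ n′ m → Weighted.AtMost p q (q ℕ.^ 2 * c) n′ m N (p ℕ.^ 2 * c))
    (∣⊤∣≡n n) (total-size≡ψ T P) (total-bound P k≤3)

theorem3p2 : (n : ℕ) (T : Graph n) → Graph.IsTree T → Graph.Subcubic T →
    (+ Φ T) / 1 ≤ ((+ 1466) / 1000) ^ ((+ 4) ℤ.* (+ n) ℤ.- (+ 5) ℤ.* (+ ψ T) ℤ.+ (+ 2))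
-- With c = 1466^4, the scale q^2 c is `D` and the final bound p^2 c is `β²`.
theorem3p2 n T = tree-bound 1466 1000 (1466 ℕ.^ 4) ((+ 1466) / 1000) _ _ refl T
  (Invariant.total-bound 1466 1000 D β² _ seed table seeded table-closed table-bounded T)
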